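{- Let $\mathbf{C}$ be a category with an initial object, let $S,T$ be monads on $\mathbf{C}$, and let $\delta\colon TS\to ST$ be a monad distributive law with $T$ constant-free. Then the monad morphism $S\eta^T\colon S\to ST$, where $ST$ carries the composite monad structure induced by $\delta$, is admissible.
   Context: A monad distributive law (Beck) $\delta\colon TS\to ST$ is a natural transformation commuting with the units and multiplications of both $S$ and $T$; it makes $ST$ a monad, and $S\eta^T\colon S\to ST$ a monad morphism. A monad $T$ on a category with initial object $\emptyset$ is constant-free iff $\eta^T_\emptyset\colon\emptyset\to T\emptyset$ is an isomorphism. A monad morphism $\alpha\colon R\to R'$ is admissible iff $\alpha_\emptyset\colon R\emptyset\to R'\emptyset$ is an isomorphism. -}

module Defs where

open import Level using (Level; suc; _⊔_)
open import Relation.Binary.Bundles using (Setoid)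
open import Relation.Binary.Core using (Rel)
open import Relation.Binary.Structures using (IsEquivalence)
import Relation.Binary.Reasoning.Setoid as SetoidReasoning

private
  variable
    o ℓ e o′ ℓ′ e′ o″ ℓ″ e″ : Level

-- Categories are enriched in setoids: equality of parallel morphisms is the
-- equivalence relation _≈_ carried by the category.  No size bound or
-- decidability is assumed.
record Category (o ℓ e : Level) : Set (suc (o ⊔ ℓ ⊔ e)) where
  infix  4 _≈_ _⇒_
  infixr 9 _∘_
  field
    Obj       : Set o
    _⇒_       : Rel Obj ℓ
    _≈_       : ∀ {A B} → Rel (A ⇒ B) e
    id        : ∀ {A} → A ⇒ A
    _∘_       : ∀ {A B C} → B ⇒ C → A ⇒ B → A ⇒ C
    equiv     : ∀ {A B} → IsEquivalence (_≈_ {A} {B})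
    assoc     : ∀ {A B C D} {f : A ⇒ B} {g : B ⇒ C} {h : C ⇒ D} →
                (h ∘ g) ∘ f ≈ h ∘ (g ∘ f)
    identityˡ : ∀ {A B} {f : A ⇒ B} → id ∘ f ≈ f
    identityʳ : ∀ {A B} {f : A ⇒ B} → f ∘ id ≈ f
    ∘-resp-≈  : ∀ {A B C} {f h : B ⇒ C} {g i : A ⇒ B} →
                f ≈ h → g ≈ i → f ∘ g ≈ h ∘ i

  module Equiv {A B : Obj} = IsEquivalence (equiv {A} {B})

  hom-setoid : Obj → Obj → Setoid ℓ e
  hom-setoid A B = record { Carrier = A ⇒ B ; _≈_ = _≈_ ; isEquivalence = equiv }

  module HomReasoning {A B : Obj} = SetoidReasoning (hom-setoid A B)

  sym-assoc : ∀ {A B C D} {f : A ⇒ B} {g : B ⇒ C} {h : C ⇒ D} →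
              h ∘ (g ∘ f) ≈ (h ∘ g) ∘ f
  sym-assoc = Equiv.sym assoc

  ∘-congˡ : ∀ {A B C} {f : B ⇒ C} {g i : A ⇒ B} → g ≈ i → f ∘ g ≈ f ∘ i
  ∘-congˡ = ∘-resp-≈ Equiv.refl

  ∘-congʳ : ∀ {A B C} {f h : B ⇒ C} {g : A ⇒ B} → f ≈ h → f ∘ g ≈ h ∘ g
  ∘-congʳ p = ∘-resp-≈ p Equiv.refl

  extend : ∀ {A B C C′ D} {a : C ⇒ D} {b : B ⇒ C} {c : C′ ⇒ D} {d : B ⇒ C′}
           {f : A ⇒ B} → a ∘ b ≈ c ∘ d → a ∘ (b ∘ f) ≈ c ∘ (d ∘ f)
  extend p = Equiv.trans sym-assoc (Equiv.trans (∘-congʳ p) assoc)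

  cancel : ∀ {A B C} {a : C ⇒ B} {b : B ⇒ C} {f : A ⇒ B} →
           a ∘ b ≈ id → a ∘ (b ∘ f) ≈ f
  cancel p = Equiv.trans sym-assoc (Equiv.trans (∘-congʳ p) identityˡ)

record IsIso (C : Category o ℓ e) {A B : Category.Obj C}
             (f : Category._⇒_ C A B) : Set (ℓ ⊔ e) where
  open Category C
  field
    inv  : B ⇒ A
    isoˡ : inv ∘ f ≈ id
    isoʳ : f ∘ inv ≈ id

record Initial (C : Category o ℓ e) : Set (o ⊔ ℓ ⊔ e) where
  open Category C
  field
    ∅        : Obj
    ¡        : ∀ {A} → ∅ ⇒ A
    ¡-unique : ∀ {A} (f : ∅ ⇒ A) → ¡ ≈ f

record Functor (C : Category o ℓ e) (D : Category o′ ℓ′ e′)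
    : Set (o ⊔ ℓ ⊔ e ⊔ o′ ⊔ ℓ′ ⊔ e′) where
  private
    module C = Category C
    module D = Category D
  field
    F₀           : C.Obj → D.Obj
    F₁           : ∀ {A B} → A C.⇒ B → F₀ A D.⇒ F₀ B
    identity     : ∀ {A} → F₁ (C.id {A}) D.≈ D.id
    homomorphism : ∀ {X Y Z} {f : X C.⇒ Y} {g : Y C.⇒ Z} →
                   F₁ (g C.∘ f) D.≈ F₁ g D.∘ F₁ f
    F-resp-≈     : ∀ {A B} {f g : A C.⇒ B} → f C.≈ g → F₁ f D.≈ F₁ g

  resp-square : ∀ {W X Y Z} {a : X C.⇒ Z} {b : W C.⇒ X} {c : Y C.⇒ Z} {d : W C.⇒ Y} →
                a C.∘ b C.≈ c C.∘ d → F₁ a D.∘ F₁ b D.≈ F₁ c D.∘ F₁ d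
  resp-square p =
    D.Equiv.trans (D.Equiv.sym homomorphism) (D.Equiv.trans (F-resp-≈ p) homomorphism)

  resp-inverse : ∀ {X Y} {a : Y C.⇒ X} {b : X C.⇒ Y} →
                 a C.∘ b C.≈ C.id → F₁ a D.∘ F₁ b D.≈ D.id
  resp-inverse p =
    D.Equiv.trans (D.Equiv.sym homomorphism) (D.Equiv.trans (F-resp-≈ p) identity)

idF : {C : Category o ℓ e} → Functor C C
idF {C = C} = record
  { F₀           = λ A → A
  ; F₁           = λ f → f
  ; identity     = Equiv.refl
  ; homomorphism = Equiv.refl
  ; F-resp-≈     = λ p → p
  }
  where open Category C

infixr 9 _∘F_

_∘F_ : {C : Category o ℓ e} {D : Category o′ ℓ′ e′} {E : Category o″ ℓ″ e″} →
       Functor D E → Functor C D → Functor C E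
_∘F_ {E = E} G F = record
  { F₀           = λ A → G.F₀ (F.F₀ A)
  ; F₁           = λ f → G.F₁ (F.F₁ f)
  ; identity     = Equiv.trans (G.F-resp-≈ F.identity) G.identity
  ; homomorphism = Equiv.trans (G.F-resp-≈ F.homomorphism) G.homomorphism
  ; F-resp-≈     = λ p → G.F-resp-≈ (F.F-resp-≈ p)
  }
  where
    open Category E
    module G = Functor G
    module F = Functor F

record NaturalTransformation {C : Category o ℓ e} {D : Category o′ ℓ′ e′}
    (F G : Functor C D) : Set (o ⊔ ℓ ⊔ ℓ′ ⊔ e′) where
  private
    module C = Category C
    module F = Functor F
    module G = Functor G
  open Category D
  field
    at      : ∀ X → F.F₀ X ⇒ G.F₀ X
    natural : ∀ {X Y} (f : X C.⇒ Y) → at Y ∘ F.F₁ f ≈ G.F₁ f ∘ at X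

record Monad (C : Category o ℓ e) : Set (o ⊔ ℓ ⊔ e) where
  open Category C
  field
    functor : Functor C C
    unit    : NaturalTransformation idF functor
    mult    : NaturalTransformation (functor ∘F functor) functor

  open Functor functor public
  module η = NaturalTransformation unit
  module μ = NaturalTransformation mult

  field
    μ-assoc     : ∀ {X} → μ.at X ∘ F₁ (μ.at X) ≈ μ.at X ∘ μ.at (F₀ X)
    μ-identityˡ : ∀ {X} → μ.at X ∘ F₁ (η.at X) ≈ id
    μ-identityʳ : ∀ {X} → μ.at X ∘ η.at (F₀ X) ≈ id

record MonadMorphism {C : Category o ℓ e} (R R′ : Monad C) : Set (o ⊔ ℓ ⊔ e) where
  private
    module R  = Monad R
    module R′ = Monad R′
  open Category C
  field
    transformation : NaturalTransformation R.functor R′.functor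

  open NaturalTransformation transformation public

  field
    unit-comp : ∀ {X} → at X ∘ R.η.at X ≈ R′.η.at X
    mult-comp : ∀ {X} → at X ∘ R.μ.at X ≈ R′.μ.at X ∘ (at (R′.F₀ X) ∘ R.F₁ (at X))

record DistributiveLaw {C : Category o ℓ e} (S T : Monad C) : Set (o ⊔ ℓ ⊔ e) where
  private
    module S = Monad S
    module T = Monad T
  open Category C
  field
    transformation : NaturalTransformation (T.functor ∘F S.functor) (S.functor ∘F T.functor)

  open NaturalTransformation transformation public

  field
    unitˢ : ∀ {X} → at X ∘ T.F₁ (S.η.at X) ≈ S.η.at (T.F₀ X)
    unitᵗ : ∀ {X} → at X ∘ T.η.at (S.F₀ X) ≈ S.F₁ (T.η.at X)
    multˢ : ∀ {X} → at X ∘ T.F₁ (S.μ.at X) ≈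
                    S.μ.at (T.F₀ X) ∘ (S.F₁ (at X) ∘ at (S.F₀ X))
    multᵗ : ∀ {X} → at X ∘ T.μ.at (S.F₀ X) ≈
                    S.F₁ (T.μ.at X) ∘ (at (T.F₀ X) ∘ T.F₁ (at X))

module _ {C : Category o ℓ e} {S T : Monad C} (δ : DistributiveLaw S T) where
  private
    module S = Monad S
    module T = Monad T
    module δ = DistributiveLaw δ
  open Category C
  open HomReasoning

  private
    η′ : ∀ X → X ⇒ S.F₀ (T.F₀ X)
    η′ X = S.η.at (T.F₀ X) ∘ T.η.at X

    -- STST → SSTT → STT → ST
    μ′ : ∀ X → S.F₀ (T.F₀ (S.F₀ (T.F₀ X))) ⇒ S.F₀ (T.F₀ X)
    μ′ X = S.F₁ (T.μ.at X) ∘ (S.μ.at (T.F₀ (T.F₀ X)) ∘ S.F₁ (δ.at (T.F₀ X)))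

    μ′-assocʳ : ∀ {X Y} {f : Y ⇒ S.F₀ (T.F₀ (S.F₀ (T.F₀ X)))} →
                μ′ X ∘ f ≈ S.F₁ (T.μ.at X) ∘
                  (S.μ.at (T.F₀ (T.F₀ X)) ∘ (S.F₁ (δ.at (T.F₀ X)) ∘ f))
    μ′-assocʳ = Equiv.trans assoc (∘-congˡ assoc)

    η′-natural : ∀ {X Y} (f : X ⇒ Y) → η′ Y ∘ f ≈ S.F₁ (T.F₁ f) ∘ η′ X
    η′-natural {X} {Y} f = begin
      (S.η.at _ ∘ T.η.at Y) ∘ f             ≈⟨ assoc ⟩
      S.η.at _ ∘ (T.η.at Y ∘ f)             ≈⟨ ∘-congˡ (T.η.natural f) ⟩
      S.η.at _ ∘ (T.F₁ f ∘ T.η.at X)        ≈⟨ extend (S.η.natural (T.F₁ f)) ⟩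
      S.F₁ (T.F₁ f) ∘ (S.η.at _ ∘ T.η.at X) ∎

    μ′-natural : ∀ {X Y} (f : X ⇒ Y) →
                 μ′ Y ∘ S.F₁ (T.F₁ (S.F₁ (T.F₁ f))) ≈ S.F₁ (T.F₁ f) ∘ μ′ X
    μ′-natural {X} {Y} f = begin
      μ′ Y ∘ S.F₁ (T.F₁ (S.F₁ (T.F₁ f)))
        ≈⟨ μ′-assocʳ ⟩
      S.F₁ (T.μ.at Y) ∘ (S.μ.at _ ∘ (S.F₁ (δ.at _) ∘ S.F₁ (T.F₁ (S.F₁ (T.F₁ f)))))
        ≈⟨ ∘-congˡ (∘-congˡ (S.resp-square (δ.natural (T.F₁ f)))) ⟩
      S.F₁ (T.μ.at Y) ∘ (S.μ.at _ ∘ (S.F₁ (S.F₁ (T.F₁ (T.F₁ f))) ∘ S.F₁ (δ.at _)))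
        ≈⟨ ∘-congˡ (extend (S.μ.natural _)) ⟩
      S.F₁ (T.μ.at Y) ∘ (S.F₁ (T.F₁ (T.F₁ f)) ∘ (S.μ.at _ ∘ S.F₁ (δ.at _)))
        ≈⟨ extend (S.resp-square (T.μ.natural f)) ⟩
      S.F₁ (T.F₁ f) ∘ μ′ X ∎

    μ′-identityˡ : ∀ {X} → μ′ X ∘ S.F₁ (T.F₁ (η′ X)) ≈ id
    μ′-identityˡ {X} = begin
      μ′ X ∘ S.F₁ (T.F₁ (η′ X))
        ≈⟨ μ′-assocʳ ⟩
      S.F₁ (T.μ.at X) ∘ (S.μ.at _ ∘ (S.F₁ (δ.at _) ∘ S.F₁ (T.F₁ (η′ X))))
        ≈⟨ ∘-congˡ (∘-congˡ (S.resp-square δη′)) ⟩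
      S.F₁ (T.μ.at X) ∘ (S.μ.at _ ∘ (S.F₁ (S.η.at _) ∘ S.F₁ (T.F₁ (T.η.at X))))
        ≈⟨ ∘-congˡ (cancel S.μ-identityˡ) ⟩
      S.F₁ (T.μ.at X) ∘ S.F₁ (T.F₁ (T.η.at X))
        ≈⟨ S.resp-inverse T.μ-identityˡ ⟩
      id ∎
      where
        δη′ : δ.at (T.F₀ X) ∘ T.F₁ (η′ X) ≈ S.η.at _ ∘ T.F₁ (T.η.at X)
        δη′ = begin
          δ.at _ ∘ T.F₁ (η′ X)                             ≈⟨ ∘-congˡ T.homomorphism ⟩
          δ.at _ ∘ (T.F₁ (S.η.at _) ∘ T.F₁ (T.η.at X))     ≈⟨ sym-assoc ⟩
          (δ.at _ ∘ T.F₁ (S.η.at _)) ∘ T.F₁ (T.η.at X)     ≈⟨ ∘-congʳ δ.unitˢ ⟩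
          S.η.at _ ∘ T.F₁ (T.η.at X)                       ∎

    μ′-identityʳ : ∀ {X} → μ′ X ∘ η′ (S.F₀ (T.F₀ X)) ≈ id
    μ′-identityʳ {X} = begin
      μ′ X ∘ η′ (S.F₀ (T.F₀ X))
        ≈⟨ μ′-assocʳ ⟩
      S.F₁ (T.μ.at X) ∘ (S.μ.at _ ∘ (S.F₁ (δ.at _) ∘ (S.η.at _ ∘ T.η.at _)))
        ≈⟨ ∘-congˡ (∘-congˡ (extend (S.η.natural _))) ⟨
      S.F₁ (T.μ.at X) ∘ (S.μ.at _ ∘ (S.η.at _ ∘ (δ.at _ ∘ T.η.at _)))
        ≈⟨ ∘-congˡ (cancel S.μ-identityʳ) ⟩
      S.F₁ (T.μ.at X) ∘ (δ.at _ ∘ T.η.at _)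
        ≈⟨ ∘-congˡ δ.unitᵗ ⟩
      S.F₁ (T.μ.at X) ∘ S.F₁ (T.η.at _)
        ≈⟨ S.resp-inverse T.μ-identityʳ ⟩
      id ∎

    μ′-assoc : ∀ {X} → μ′ X ∘ S.F₁ (T.F₁ (μ′ X)) ≈ μ′ X ∘ μ′ (S.F₀ (T.F₀ X))
    μ′-assoc {X} = begin
      μ′ X ∘ S.F₁ (T.F₁ (μ′ X))
        ≈⟨ μ′-assocʳ ⟩
      S.F₁ (T.μ.at X) ∘ (S.μ.at _ ∘ (S.F₁ (δ.at _) ∘ S.F₁ (T.F₁ (μ′ X))))
        ≈⟨ ∘-congˡ (∘-congˡ (S.resp-square δμ′)) ⟩
      S.F₁ (T.μ.at X) ∘ (S.μ.at _ ∘ (S.F₁ (S.F₁ (T.F₁ (T.μ.at X))) ∘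
        S.F₁ (S.μ.at _ ∘ (S.F₁ d ∘ δ.at _))))
        ≈⟨ ∘-congˡ (extend (S.μ.natural _)) ⟩
      S.F₁ (T.μ.at X) ∘ (S.F₁ (T.F₁ (T.μ.at X)) ∘ (S.μ.at _ ∘
        S.F₁ (S.μ.at _ ∘ (S.F₁ d ∘ δ.at _))))
        ≈⟨ extend (S.resp-square T.μ-assoc) ⟩
      S.F₁ (T.μ.at X) ∘ (S.F₁ (T.μ.at _) ∘ (S.μ.at _ ∘
        S.F₁ (S.μ.at _ ∘ (S.F₁ d ∘ δ.at _))))
        ≈⟨ ∘-congˡ (∘-congˡ (∘-congˡ S.homomorphism)) ⟩
      S.F₁ (T.μ.at X) ∘ (S.F₁ (T.μ.at _) ∘ (S.μ.at _ ∘
        (S.F₁ (S.μ.at _) ∘ S.F₁ (S.F₁ d ∘ δ.at _))))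
        ≈⟨ ∘-congˡ (∘-congˡ (extend S.μ-assoc)) ⟩
      S.F₁ (T.μ.at X) ∘ (S.F₁ (T.μ.at _) ∘ (S.μ.at _ ∘
        (S.μ.at _ ∘ S.F₁ (S.F₁ d ∘ δ.at _))))
        ≈⟨ ∘-congˡ (∘-congˡ (∘-congˡ (∘-congˡ S.homomorphism))) ⟩
      S.F₁ (T.μ.at X) ∘ (S.F₁ (T.μ.at _) ∘ (S.μ.at _ ∘
        (S.μ.at _ ∘ (S.F₁ (S.F₁ d) ∘ S.F₁ (δ.at _)))))
        ≈⟨ ∘-congˡ (∘-congˡ (∘-congˡ (extend (S.μ.natural d)))) ⟩
      S.F₁ (T.μ.at X) ∘ (S.F₁ (T.μ.at _) ∘ (S.μ.at _ ∘
        (S.F₁ d ∘ (S.μ.at _ ∘ S.F₁ (δ.at _)))))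
        ≈⟨ ∘-congˡ (extend (S.μ.natural (T.μ.at _))) ⟨
      S.F₁ (T.μ.at X) ∘ (S.μ.at _ ∘ (S.F₁ (S.F₁ (T.μ.at _)) ∘
        (S.F₁ d ∘ (S.μ.at _ ∘ S.F₁ (δ.at _)))))
        ≈⟨ ∘-congˡ (∘-congˡ (extend (S.resp-square δ.multᵗ))) ⟨
      S.F₁ (T.μ.at X) ∘ (S.μ.at _ ∘ (S.F₁ (δ.at _) ∘ μ′ (S.F₀ (T.F₀ X))))
        ≈⟨ μ′-assocʳ ⟨
      μ′ X ∘ μ′ (S.F₀ (T.F₀ X)) ∎
      where
        d = δ.at (T.F₀ (T.F₀ X)) ∘ T.F₁ (δ.at (T.F₀ X))

        δμ′ : δ.at (T.F₀ X) ∘ T.F₁ (μ′ X) ≈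
              S.F₁ (T.F₁ (T.μ.at X)) ∘ (S.μ.at _ ∘ (S.F₁ d ∘ δ.at _))
        δμ′ = begin
          δ.at _ ∘ T.F₁ (μ′ X)
            ≈⟨ ∘-congˡ (Equiv.trans T.homomorphism (∘-congˡ T.homomorphism)) ⟩
          δ.at _ ∘ (T.F₁ (S.F₁ (T.μ.at X)) ∘ (T.F₁ (S.μ.at _) ∘ T.F₁ (S.F₁ (δ.at _))))
            ≈⟨ extend (δ.natural (T.μ.at X)) ⟩
          S.F₁ (T.F₁ (T.μ.at X)) ∘ (δ.at _ ∘ (T.F₁ (S.μ.at _) ∘ T.F₁ (S.F₁ (δ.at _))))
            ≈⟨ ∘-congˡ (extend δ.multˢ) ⟩
          S.F₁ (T.F₁ (T.μ.at X)) ∘ (S.μ.at _ ∘ ((S.F₁ (δ.at _) ∘ δ.at _) ∘ T.F₁ (S.F₁ (δ.at _))))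
            ≈⟨ ∘-congˡ (∘-congˡ assoc) ⟩
          S.F₁ (T.F₁ (T.μ.at X)) ∘ (S.μ.at _ ∘ (S.F₁ (δ.at _) ∘ (δ.at _ ∘ T.F₁ (S.F₁ (δ.at _)))))
            ≈⟨ ∘-congˡ (∘-congˡ (∘-congˡ (δ.natural _))) ⟩
          S.F₁ (T.F₁ (T.μ.at X)) ∘ (S.μ.at _ ∘ (S.F₁ (δ.at _) ∘ (S.F₁ (T.F₁ (δ.at _)) ∘ δ.at _)))
            ≈⟨ ∘-congˡ (∘-congˡ sym-assoc) ⟩
          S.F₁ (T.F₁ (T.μ.at X)) ∘ (S.μ.at _ ∘ ((S.F₁ (δ.at _) ∘ S.F₁ (T.F₁ (δ.at _))) ∘ δ.at _))
            ≈⟨ ∘-congˡ (∘-congˡ (∘-congʳ S.homomorphism)) ⟨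
          S.F₁ (T.F₁ (T.μ.at X)) ∘ (S.μ.at _ ∘ (S.F₁ d ∘ δ.at _)) ∎

  compositeMonad : Monad C
  compositeMonad = record
    { functor     = S.functor ∘F T.functor
    ; unit        = record { at = η′ ; natural = η′-natural }
    ; mult        = record { at = μ′ ; natural = μ′-natural }
    ; μ-assoc     = μ′-assoc
    ; μ-identityˡ = μ′-identityˡ
    ; μ-identityʳ = μ′-identityʳ
    }

  -- Sηᵀ : S → ST
  leftInclusion : MonadMorphism S compositeMonad
  leftInclusion = record
    { transformation = record
        { at      = λ X → S.F₁ (T.η.at X)
        ; natural = λ f → S.resp-square (T.η.natural f)
        }
    ; unit-comp = λ {X} → Equiv.sym (S.η.natural (T.η.at X))
    ; mult-comp = λ {X} → Equiv.sym (begin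
        μ′ X ∘ (S.F₁ (T.η.at _) ∘ S.F₁ (S.F₁ (T.η.at X)))
          ≈⟨ μ′-assocʳ ⟩
        S.F₁ (T.μ.at X) ∘ (S.μ.at _ ∘ (S.F₁ (δ.at _) ∘
          (S.F₁ (T.η.at _) ∘ S.F₁ (S.F₁ (T.η.at X)))))
          ≈⟨ ∘-congˡ (∘-congˡ sym-assoc) ⟩
        S.F₁ (T.μ.at X) ∘ (S.μ.at _ ∘ ((S.F₁ (δ.at _) ∘ S.F₁ (T.η.at _)) ∘
          S.F₁ (S.F₁ (T.η.at X))))
          ≈⟨ ∘-congˡ (∘-congˡ (∘-congʳ
               (Equiv.trans (Equiv.sym S.homomorphism) (S.F-resp-≈ δ.unitᵗ)))) ⟩
        S.F₁ (T.μ.at X) ∘ (S.μ.at _ ∘ (S.F₁ (S.F₁ (T.η.at _)) ∘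
          S.F₁ (S.F₁ (T.η.at X))))
          ≈⟨ ∘-congˡ (extend (S.μ.natural _)) ⟩
        S.F₁ (T.μ.at X) ∘ (S.F₁ (T.η.at _) ∘ (S.μ.at _ ∘ S.F₁ (S.F₁ (T.η.at X))))
          ≈⟨ cancel (S.resp-inverse T.μ-identityʳ) ⟩
        S.μ.at _ ∘ S.F₁ (S.F₁ (T.η.at X))
          ≈⟨ S.μ.natural _ ⟩
        S.F₁ (T.η.at X) ∘ S.μ.at X ∎)
    }

module _ {C : Category o ℓ e} (I : Initial C) where
  open Initial I using (∅)

  ConstantFree : Monad C → Set (ℓ ⊔ e)
  ConstantFree T = IsIso C (Monad.η.at T ∅)

  Admissible : {R R′ : Monad C} → MonadMorphism R R′ → Set (ℓ ⊔ e)
  Admissible α = IsIso C (MonadMorphism.at α ∅)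

{-# OPTIONS --safe #-}
module Submission where

open import Defs
open import Level using (Level)

-- The component at `∅` of the morphism from S to ST is the functor S applied to the unit of T at
-- `∅`. Constant-freeness makes that unit invertible, and functors preserve isomorphisms.

F-resp-IsIso : {o ℓ e o′ ℓ′ e′ : Level} {C : Category o ℓ e} {D : Category o′ ℓ′ e′}
    (F : Functor C D) {A B : Category.Obj C} {f : Category._⇒_ C A B} →
    IsIso C f → IsIso D (Functor.F₁ F f)
F-resp-IsIso F f-iso = record
  { inv  = F₁ inv
  ; isoˡ = resp-inverse isoˡ
  ; isoʳ = resp-inverse isoʳ
  }
  where
    open Functor F
    open IsIso f-iso

proposition2p7 : {o ℓ e : Level} (C : Category o ℓ e) (I : Initial C)
    (S T : Monad C) (δ : DistributiveLaw S T) →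
    ConstantFree I T → Admissible I (leftInclusion δ)
-- `MonadMorphism.at (leftInclusion δ) ∅` unfolds to `S.F₁ (T.η.at ∅)`, so the two `IsIso` types
-- match definitionally.
proposition2p7 C I S T δ = F-resp-IsIso (Monad.functor S)
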